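{- Let $n\ge 1$ and $0\le p\le n$ be integers. In the feedback game on the octahedral path $E_n$ with starting vertex $u_p$, the winner is as follows (all congruences modulo $3$): if $n\equiv 0$, Alice wins for every $p$; if $n\equiv 1$, Bob wins when $p\equiv 0$ or $p\equiv 1$, and Alice wins when $p\equiv 2$; if $n\equiv 2$, Bob wins when $p\equiv 1$, and Alice wins when $p\equiv 0$ or $p\equiv 2$.
   Context: The octahedral path $E_n$ ($n\ge1$) is the graph on vertices $u_i,v_i,w_i$ ($0\le i\le n$) whose edges are: $u_iv_i, v_iw_i, w_iu_i$ for $0\le i\le n$, and $u_iu_{i+1}, u_iw_{i+1}, v_iv_{i+1}, v_iu_{i+1}, w_iw_{i+1}, w_iv_{i+1}$ for $0\le i\le n-1$. (It is the Eulerian triangulation of the sphere obtained from the octahedron $E_1$ by repeatedly adding an octahedron inside a face; by symmetry the choice among $u_p,v_p,w_p$ as starting vertex does not matter.) The feedback game on a connected graph $G$ with a starting vertex $s$: a token is placed on $s$; two players, Alice (who moves first) and Bob, alternately move the token from its current vertex $u$ to a vertex $v$ adjacent to $u$, and the edge $uv$ is then deleted. The first player who moves the token back to $s$, or to a vertex that is isolated after deletion of the edge just used, wins. "X wins the game" means X has a winning strategy. -}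

module Defs where

open import Data.Nat using (ℕ; suc)
open import Data.Product using (_×_; _,_; proj₁; proj₂)
open import Data.Sum using (_⊎_)
open import Data.List using (List; []; _∷_; _++_)
open import Data.List.Relation.Unary.All using (All)
open import Relation.Binary.PropositionalEquality using (_≡_; _≢_)
open import Relation.Nullary using (¬_)

-- Generic feedback game on a finite simple graph given by its edge list.
-- An edge is an (unordered) pair, stored as an ordered pair; the list of
-- remaining edges is the current graph.

module FeedbackGame {V : Set} where

  Edge : Set
  Edge = V × V

  data Remove (x y : V) : List Edge → List Edge → Set where
    here₁ : ∀ {E} → Remove x y ((x , y) ∷ E) E
    here₂ : ∀ {E} → Remove x y ((y , x) ∷ E) E
    there : ∀ {e E E'} → Remove x y E E' → Remove x y (e ∷ E) (e ∷ E')

  Isolated : V → List Edge → Set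
  Isolated y E = All (λ e → (proj₁ e ≢ y) × (proj₂ e ≢ y)) E

  mutual
    -- The player about to move (token on x, remaining edges E, start s)
    -- has a winning strategy.
    data Win (s : V) : List Edge → V → Set where
      win : ∀ {E x y E'} → Remove x y E E' →
            (y ≡ s ⊎ (Isolated y E' ⊎ Lose s E' y)) → Win s E x

    data Lose (s : V) : List Edge → V → Set where
      lose : ∀ {E x} →
             (∀ {y E'} → Remove x y E E' →
                (y ≢ s) × (¬ Isolated y E') × Win s E' y) → Lose s E x

  AliceWins : List Edge → V → Set
  AliceWins G s = Win s G s

  BobWins : List Edge → V → Set
  BobWins G s = Lose s G s

data Layer : Set where
  U V W : Layer

OVertex : Set
OVertex = ℕ × Layer

u v w : ℕ → OVertex
u i = i , U
v i = i , V
w i = i , W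

triangle : ℕ → List (OVertex × OVertex)
triangle i = (u i , v i) ∷ (v i , w i) ∷ (w i , u i) ∷ []

connect : ℕ → List (OVertex × OVertex)
connect i = (u i , u (suc i)) ∷ (u i , w (suc i)) ∷ (v i , v (suc i))
          ∷ (v i , u (suc i)) ∷ (w i , w (suc i)) ∷ (w i , v (suc i)) ∷ []

octPath : ℕ → List (OVertex × OVertex)
octPath 0 = triangle 0
octPath (suc n) = octPath n ++ (connect n ++ triangle (suc n))

{-# OPTIONS --safe #-}
module Submission where

-- After recolouring layer i by a shift of i mod 3, two vertices of E_n are
-- adjacent exactly when their layers differ by at most 1 and their colours
-- differ.
--
-- A player wins by always moving into an independent set P that the opponent
-- must leave: if every vertex outside P either is still joined to s or has an
-- even number of edges into P, then after the opponent steps out of P there is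
-- an edge to s or an odd number of edges back into P.
--
-- Take P to be the vertices of one colour in a set g of layers. A vertex of
-- another colour in layer i sees g(i-1) + g(i) + g(i+1) of them, so parity
-- forces g to have period 3 with two layers out of three chosen (110110...),
-- starting 11 at one end of the path or ending 11 at the other. Alice uses a
-- colour other than that of s, with exactly one neighbour of s in P; it is her
-- opening move. Bob uses the colour of s, on one side of s only, depending on
-- Alice's opening.

open import Defs
open import Data.Bool using (Bool; true; false; _∧_; if_then_else_)
open import Data.Bool.Properties using (∧-zeroʳ)
open import Data.List using (List; []; _∷_; _++_; length; map)
open import Data.List.Properties using (map-++)
open import Data.List.Relation.Unary.All using (_∷_)
open import Data.Nat using (ℕ; zero; suc; _+_; _*_; _≤_; _<_; z≤n; s≤s; _%_; parity; _≡ᵇ_)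
open import Data.Nat.DivMod using (m%n<n)
open import Data.Nat.ListAction using (sum)
open import Data.Nat.ListAction.Properties using (sum-++)
open import Data.Nat.Properties
open import Data.Parity using (0ℙ; 1ℙ; _⁻¹)
open import Data.Parity.Properties using (suc-homo-⁻¹)
open import Data.Product using (_×_; _,_; proj₁; proj₂; ∃; ∃₂)
open import Data.Sum using (_⊎_; inj₁; inj₂) renaming (map to ⊎-map)
open import Relation.Binary.Definitions using (DecidableEquality; tri<; tri≈; tri>)
open import Relation.Binary.PropositionalEquality
open import Relation.Nullary using (¬_; yes; no; does; contradiction)
open import Relation.Nullary.Decidable using (dec-true; dec-false; map′; _×-dec_)
open FeedbackGame using (AliceWins; BobWins)

-- Winning positions of the feedback game from parity conditions.

odd⇒≢0 : ∀ {n} → parity n ≡ 1ℙ → n ≢ 0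
odd⇒≢0 () refl

toℕ : Bool → ℕ
toℕ true  = 1
toℕ false = 0

module Kernels {V : Set} (_≟ⱽ_ : DecidableEquality V) where
  open FeedbackGame {V} hiding (AliceWins; BobWins)

  isV : V → V → Bool
  isV x y = does (x ≟ⱽ y)

  hit : (V → Bool) → V → Edge → ℕ
  hit P z (x , y) = toℕ (isV x z ∧ P y) + toℕ (isV y z ∧ P x)

  -- For `P = isV s` this counts the edges still joining `z` to `s`, so the same lemmas serve both
  -- clauses of `Harmless`.
  deg : (V → Bool) → V → List Edge → ℕ
  deg P z E = sum (map (hit P z) E)

  deg-++ : ∀ P z E F → deg P z (E ++ F) ≡ deg P z E + deg P z F
  deg-++ P z E F = trans (cong sum (map-++ (hit P z) E F)) (sum-++ (map (hit P z) E) _)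

  hit-away : ∀ P {z x y} → x ≢ z → y ≢ z → hit P z (x , y) ≡ 0
  hit-away P {z} {x} {y} x≢z y≢z
    rewrite dec-false (x ≟ⱽ z) x≢z | dec-false (y ≟ⱽ z) y≢z = refl

  hit-end : ∀ P {x y} → x ≢ y → P x ≡ true → hit P y (x , y) ≡ 1
  hit-end P {x} {y} x≢y Px
    rewrite dec-false (x ≟ⱽ y) x≢y | dec-true (y ≟ⱽ y) refl | Px = refl

  hit-start : ∀ P {x y} → y ≢ x → P y ≡ true → hit P x (x , y) ≡ 1
  hit-start P {x} {y} y≢x Py
    rewrite dec-false (y ≟ⱽ x) y≢x | dec-true (x ≟ⱽ x) refl | Py = refl

  hit-outside : ∀ P {z x y} → P x ≡ false → P y ≡ false → hit P z (x , y) ≡ 0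
  hit-outside P {z} {x} {y} ¬Px ¬Py
    rewrite ¬Px | ¬Py | ∧-zeroʳ (isV x z) | ∧-zeroʳ (isV y z) = refl

  hit-swap : ∀ P z x y → hit P z (y , x) ≡ hit P z (x , y)
  hit-swap P z x y = +-comm (toℕ (isV y z ∧ P x)) _

  deg-remove : ∀ P z {x y E E'} → Remove x y E E' →
               deg P z E ≡ hit P z (x , y) + deg P z E'
  deg-remove P z here₁ = refl
  deg-remove P z {x} {y} {E' = E'} here₂ = cong (_+ deg P z E') (hit-swap P z x y)
  deg-remove P z {x} {y} (there {e} {E} {E'} r) = begin
    hit P z e + deg P z E                      ≡⟨ cong (hit P z e +_) (deg-remove P z r) ⟩
    hit P z e + (hit P z (x , y) + deg P z E') ≡⟨ +-assoc (hit P z e) _ _ ⟨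
    hit P z e + hit P z (x , y) + deg P z E'   ≡⟨ cong (_+ deg P z E') (+-comm (hit P z e) _) ⟩
    hit P z (x , y) + hit P z e + deg P z E'   ≡⟨ +-assoc (hit P z (x , y)) _ _ ⟩
    hit P z (x , y) + (hit P z e + deg P z E') ∎
    where open ≡-Reasoning

  deg-keep : ∀ P z {x y E E'} → Remove x y E E' → hit P z (x , y) ≡ 0 →
             deg P z E' ≡ deg P z E
  deg-keep P z {E' = E'} r h0 = sym (trans (deg-remove P z r) (cong (_+ deg P z E') h0))

  deg-drop : ∀ P z {x y E E'} → Remove x y E E' → hit P z (x , y) ≡ 1 →
             deg P z E ≡ suc (deg P z E')
  deg-drop P z {E' = E'} r h1 = trans (deg-remove P z r) (cong (_+ deg P z E') h1)

  deg-target : ∀ P {x y E E'} → Remove x y E E' → P x ≡ true → deg P y E ≢ 0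
  deg-target P {x} {y} r Px d0
    with m+n≡0⇒n≡0 (toℕ (isV x y ∧ P y)) (m+n≡0⇒m≡0 _ (trans (sym (deg-remove P y r)) d0))
  ... | e rewrite dec-true (y ≟ⱽ y) refl | Px = contradiction e λ ()

  deg-source : ∀ P {x y E E'} → Remove x y E E' → P y ≡ true → deg P x E ≢ 0
  deg-source P {x} {y} r Py d0
    with m+n≡0⇒m≡0 (toℕ (isV x x ∧ P y)) (m+n≡0⇒m≡0 _ (trans (sym (deg-remove P x r)) d0))
  ... | e rewrite dec-true (x ≟ⱽ x) refl | Py = contradiction e λ ()

  incident : ∀ (P : V → Bool) x z y → toℕ (isV x z ∧ P y) ≢ 0 → x ≡ z × P y ≡ true
  incident P x z y h≢0 with x ≟ⱽ z | P y
  ... | yes x≡z | true  = x≡z , refl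
  ... | yes _   | false = contradiction refl h≢0
  ... | no _    | _     = contradiction refl h≢0

  deg≢0⇒move : ∀ P z E → deg P z E ≢ 0 → ∃₂ λ y E' → Remove z y E E' × P y ≡ true
  deg≢0⇒move P z []            d≢0 = contradiction refl d≢0
  deg≢0⇒move P z ((x , y) ∷ E) d≢0
    with toℕ (isV x z ∧ P y) ≟ 0 | toℕ (isV y z ∧ P x) ≟ 0
  ... | no h≢0 | _ with refl , Py ← incident P x z y h≢0 = y , E , here₁ , Py
  ... | yes _  | no h≢0 with refl , Px ← incident P y z x h≢0 = x , E , here₂ , Px
  ... | yes h₁ | yes h₂ =
    let y' , E' , r , Py' = deg≢0⇒move P z E λ d0 → d≢0 (cong₂ _+_ (cong₂ _+_ h₁ h₂) d0)
    in y' , (x , y) ∷ E' , there r , Py'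

  move⇒¬isolated : ∀ {x y E E'} → Remove x y E E' → ¬ Isolated x E
  move⇒¬isolated here₁     ((x≢ , _) ∷ _) = x≢ refl
  move⇒¬isolated here₂     ((_ , x≢) ∷ _) = x≢ refl
  move⇒¬isolated (there r) (_ ∷ iso)      = move⇒¬isolated r iso

  -- A winner needs an edge to move along, so the clause of `Lose` about isolated vertices follows
  -- from the one about `Win`.
  win⇒¬isolated : ∀ {s E x} → Win s E x → ¬ Isolated x E
  win⇒¬isolated (win r _) = move⇒¬isolated r

  remove-length : ∀ {x y E E'} → Remove x y E E' → length E ≡ suc (length E')
  remove-length here₁     = refl
  remove-length here₂     = refl
  remove-length (there r) = cong suc (remove-length r)

  -- z is harmless for the player owning P if stepping on it lets that player
  -- win at once at s, or leaves an odd number of edges back into P.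
  Harmless : V → (V → Bool) → List Edge → V → Set
  Harmless s P E z = deg (isV s) z E ≢ 0 ⊎ parity (deg P z E) ≡ 0ℙ

  -- The opponent is to move from a vertex of `P`. By `s-free` no such move reaches `s`, and this
  -- persists because edges are only deleted.
  record Kernel (s : V) (P : V → Bool) (E : List Edge) : Set where
    field
      s∉P         : P s ≡ false
      s-free      : deg P s E ≡ 0
      independent : ∀ z → P z ≡ true → deg P z E ≡ 0
      harmless    : ∀ z → P z ≡ false → z ≢ s → Harmless s P E z

  -- The owner of `P` is to move from `y`. Oddness at `y` provides a move into `P`, and that move
  -- restores evenness there.
  record KernelBut (y s : V) (P : V → Bool) (E : List Edge) : Set where
    field
      s∉P         : P s ≡ false
      s-free      : deg P s E ≡ 0
      independent : ∀ z → P z ≡ true → deg P z E ≡ 0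
      harmless    : ∀ z → P z ≡ false → z ≢ s → z ≢ y → Harmless s P E z
      target-odd  : parity (deg P y E) ≡ 1ℙ

    y∉P : P y ≡ false
    y∉P with P y in Py
    ... | false = refl
    ... | true  = contradiction (independent y Py) (odd⇒≢0 target-odd)

    y≢s : y ≢ s
    y≢s refl = odd⇒≢0 target-odd s-free

  distinct : ∀ {P : V → Bool} {x y} → P x ≡ true → P y ≡ false → x ≢ y
  distinct Px ¬Py refl = contradiction (trans (sym Px) ¬Py) λ ()

  deg-0-remove : ∀ P z {x y E E'} → Remove x y E E' → deg P z E ≡ 0 → deg P z E' ≡ 0
  deg-0-remove P z {x} {y} r d0 =
    m+n≡0⇒n≡0 (hit P z (x , y)) (trans (sym (deg-remove P z r)) d0)

  harmless-remove : ∀ {s P z x y E E'} → Remove x y E E' → x ≢ z → y ≢ z →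
                    Harmless s P E z → Harmless s P E' z
  harmless-remove {s} {P} {z} r x≢z y≢z (inj₁ d) =
    inj₁ (subst (_≢ 0) (sym (deg-keep (isV s) z r (hit-away (isV s) x≢z y≢z))) d)
  harmless-remove {s} {P} {z} r x≢z y≢z (inj₂ d) =
    inj₂ (trans (cong parity (deg-keep P z r (hit-away P x≢z y≢z))) d)

  -- The deleted edge turns the even count at `y` into an odd one; its other end lies in `P`, where
  -- no parity is asked.
  leave-kernel : ∀ {s P x y E E'} → Remove x y E E' → Kernel s P E → P x ≡ true →
                 P y ≡ false → parity (deg P y E) ≡ 0ℙ → KernelBut y s P E'
  leave-kernel {s} {P} {x} {y} {E} {E'} r K Px ¬Py even = record
    { s∉P         = s∉P
    ; s-free      = deg-0-remove P s r s-free
    ; independent = λ z Pz → deg-0-remove P z r (independent z Pz)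
    ; harmless    = λ z ¬Pz z≢s z≢y →
        harmless-remove r (distinct {P} Px ¬Pz) (≢-sym z≢y) (harmless z ¬Pz z≢s)
    ; target-odd  = begin
        parity (deg P y E')           ≡⟨ suc-homo-⁻¹ (deg P y E') ⟨
        parity (suc (deg P y E')) ⁻¹
          ≡⟨ cong (λ d → parity d ⁻¹) (deg-drop P y r (hit-end P (distinct {P} Px ¬Py) Px)) ⟨
        parity (deg P y E) ⁻¹         ≡⟨ cong _⁻¹ even ⟩
        1ℙ                            ∎
    }
    where
    open Kernel K
    open ≡-Reasoning

  -- Moving back into `P` spends one of the odd number of edges from `y`, so `y` becomes harmless
  -- again.
  enter-kernel : ∀ {s P y z E E'} → Remove y z E E' → KernelBut y s P E → P z ≡ true →
                 Kernel s P E'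
  enter-kernel {s} {P} {y} {z} {E} {E'} r K Pz = record
    { s∉P         = s∉P
    ; s-free      = deg-0-remove P s r s-free
    ; independent = λ t Pt → deg-0-remove P t r (independent t Pt)
    ; harmless    = safe
    }
    where
    open KernelBut K
    open ≡-Reasoning
    safe : ∀ t → P t ≡ false → t ≢ s → Harmless s P E' t
    safe t ¬Pt t≢s with t ≟ⱽ y
    ... | no t≢y = harmless-remove r (≢-sym t≢y) (distinct {P} Pz ¬Pt) (harmless t ¬Pt t≢s t≢y)
    ... | yes refl = inj₂ (begin
        parity (deg P y E')           ≡⟨ suc-homo-⁻¹ (deg P y E') ⟨
        parity (suc (deg P y E')) ⁻¹
          ≡⟨ cong (λ d → parity d ⁻¹) (deg-drop P y r (hit-start P (distinct {P} Pz y∉P) Pz)) ⟨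
        parity (deg P y E) ⁻¹         ≡⟨ cong _⁻¹ target-odd ⟩
        0ℙ                            ∎)

  move-to : ∀ {s} z E → deg (isV s) z E ≢ 0 → ∃ λ E' → Remove z s E E'
  move-to {s} z E d≢0 with deg≢0⇒move (isV s) z E d≢0
  ... | y , E' , r , s=y with s ≟ⱽ y
  ... | yes refl = E' , r

  mutual
    -- The bound `k` on the number of remaining edges drives the mutual recursion: it decreases at
    -- every move, whereas `E'` is not a subterm of `E` in general.
    kernel⇒lose : ∀ {s P x} k E → length E ≤ k → Kernel s P E → P x ≡ true → Lose s E x
    kernel⇒lose {s} {P} {x} k E l≤k K Px = lose reply
      where
      open Kernel K
      reply : ∀ {y E'} → Remove x y E E' → (y ≢ s) × (¬ Isolated y E') × Win s E' y
      reply {y} {E'} r = y≢s , win⇒¬isolated y-wins , y-wins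
        where
        y≢s : y ≢ s
        y≢s refl = deg-target P r Px s-free

        ¬Py : P y ≡ false
        ¬Py with P y in Py
        ... | false = refl
        ... | true  = contradiction (independent y Py) (deg-target P r Px)

        -- The edge just used avoids `s`, so an edge from `y` to `s` survives the move.
        xy-misses-s : hit (isV s) y (x , y) ≡ 0
        xy-misses-s = hit-outside (isV s) (dec-false (s ≟ⱽ x) (≢-sym (distinct {P} Px s∉P)))
                                          (dec-false (s ≟ⱽ y) (≢-sym y≢s))

        continue : ∀ k → suc (length E') ≤ k → Harmless s P E y → Win s E' y
        continue (suc k) (s≤s l≤k) (inj₂ even) =
          kernelBut⇒win k E' l≤k (leave-kernel r K Px ¬Py even)
        continue _ _ (inj₁ d) =
          win (proj₂ (move-to y E' (subst (_≢ 0) (sym (deg-keep (isV s) y r xy-misses-s)) d)))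
              (inj₁ refl)

        y-wins : Win s E' y
        y-wins = continue k (subst (_≤ k) (remove-length r) l≤k) (harmless y ¬Py y≢s)

    kernelBut⇒win : ∀ {s P y} k E → length E ≤ k → KernelBut y s P E → Win s E y
    kernelBut⇒win {s} {P} {y} k E l≤k K =
      let z , E' , r , Pz = deg≢0⇒move P y E (odd⇒≢0 (KernelBut.target-odd K))
      in continue k r (subst (_≤ k) (remove-length r) l≤k) Pz
      where
      continue : ∀ {z E'} k → Remove y z E E' → suc (length E') ≤ k → P z ≡ true → Win s E y
      continue {E' = E'} (suc k) r (s≤s l≤k) Pz =
        win r (inj₂ (inj₂ (kernel⇒lose k E' l≤k (enter-kernel r K Pz) Pz)))

  -- The sets are described on the full graph: the opening edge joins two vertices outside `P`, so
  -- deleting it changes no count into `P`.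
  kernels⇒bobWins : ∀ s E → (∀ y → deg (isV y) s E ≢ 0 → ∃ λ P → KernelBut y s P E) →
                    BobWins E s
  kernels⇒bobWins s E kernel = lose λ {y} {E'} r →
    let P , K = kernel y (deg-source (isV y) r (dec-true (y ≟ⱽ y) refl))
        y-wins = kernelBut⇒win (length E') E' ≤-refl (after-opening P r K)
    in KernelBut.y≢s K , win⇒¬isolated y-wins , y-wins
    where
    after-opening : ∀ P {y E'} → Remove s y E E' → KernelBut y s P E → KernelBut y s P E'
    after-opening P {y} {E'} r K = record
      { s∉P         = s∉P
      ; s-free      = trans (same s) s-free
      ; independent = λ z Pz → trans (same z) (independent z Pz)
      ; harmless    = λ z ¬Pz z≢s z≢y →
          harmless-remove r (≢-sym z≢s) (≢-sym z≢y) (harmless z ¬Pz z≢s z≢y)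
      ; target-odd  = trans (cong parity (same y)) target-odd
      }
      where
      open KernelBut K
      same : ∀ z → deg P z E' ≡ deg P z E
      same z = deg-keep P z r (hit-outside P s∉P y∉P)

  -- The one edge from `s` into `P` is Alice's opening; its deletion leaves `s` without edges into
  -- `P`, as `Kernel` demands.
  kernel⇒aliceWins : ∀ s E P → P s ≡ false → deg P s E ≡ 1 →
                     (∀ z → P z ≡ true → deg P z E ≡ 0) →
                     (∀ z → P z ≡ false → z ≢ s → Harmless s P E z) →
                     AliceWins E s
  kernel⇒aliceWins s E P s∉P one independent harmless
    with deg≢0⇒move P s E (λ d0 → contradiction (trans (sym one) d0) λ ())
  ... | x , E' , r , Px = win r (inj₂ (inj₂ (kernel⇒lose (length E') E' ≤-refl after-opening Px)))
    where
    x≢s : x ≢ s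
    x≢s = distinct {P} Px s∉P

    after-opening : Kernel s P E'
    after-opening = record
      { s∉P         = s∉P
      ; s-free      = suc-injective (trans (sym (deg-drop P s r (hit-start P x≢s Px))) one)
      ; independent = λ z Pz → deg-0-remove P z r (independent z Pz)
      ; harmless    = λ z ¬Pz z≢s →
          harmless-remove r (≢-sym z≢s) (distinct {P} Px ¬Pz) (harmless z ¬Pz z≢s)
      }

-- Vertices of the octahedral path and their colours.

_≟ˡ_ : DecidableEquality Layer
U ≟ˡ U = yes refl
U ≟ˡ V = no λ ()
U ≟ˡ W = no λ ()
V ≟ˡ U = no λ ()
V ≟ˡ V = yes refl
V ≟ˡ W = no λ ()
W ≟ˡ U = no λ ()
W ≟ˡ V = no λ ()
W ≟ˡ W = yes refl

_≟ᵒ_ : DecidableEquality OVertex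
(i , c) ≟ᵒ (j , d) =
  map′ (λ (p , q) → cong₂ _,_ p q) (λ e → cong proj₁ e , cong proj₂ e) (i ≟ j ×-dec c ≟ˡ d)

open Kernels _≟ᵒ_

next prev : Layer → Layer
next U = V
next V = W
next W = U
prev U = W
prev V = U
prev W = V

-- With this colouring, (i , c) and (j , d) are adjacent iff |i - j| ≤ 1 and
-- their colours differ.
colour : ℕ → Layer → Layer
colour zero    c = c
colour (suc i) c = colour i (prev c)

colour-next : ∀ i c → colour i (next c) ≡ next (colour i c)
colour-next zero    c = refl
colour-next (suc i) U = colour-next i W
colour-next (suc i) V = colour-next i U
colour-next (suc i) W = colour-next i V

colour-prev : ∀ i c → colour i (prev c) ≡ prev (colour i c)
colour-prev zero    c = refl
colour-prev (suc i) c = colour-prev i (prev c)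

prev-injective : ∀ c d → prev c ≡ prev d → c ≡ d
prev-injective U U _ = refl
prev-injective V V _ = refl
prev-injective W W _ = refl

colour-injective : ∀ i {c d} → colour i c ≡ colour i d → c ≡ d
colour-injective zero    e = e
colour-injective (suc i) e = prev-injective _ _ (colour-injective i e)

-- Counting edges into a band of one colour.

band : (ℕ → Bool) → Layer → OVertex → Bool
band g b (i , c) = g i ∧ does (colour i c ≟ˡ b)

differ : Layer → Layer → ℕ
differ a b = if does (a ≟ˡ b) then 0 else 1

-- Exactly one of the two colours besides `a` equals `b`, unless `a` itself is `b`.
other-two : ∀ x a b → toℕ (x ∧ does (next a ≟ˡ b)) + toℕ (x ∧ does (prev a ≟ˡ b)) ≡ differ a b * toℕ x
other-two false a b = sym (*-zeroʳ (differ a b))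
other-two true U U = refl
other-two true U V = refl
other-two true U W = refl
other-two true V U = refl
other-two true V V = refl
other-two true V W = refl
other-two true W U = refl
other-two true W V = refl
other-two true W W = refl

module _ (g : ℕ → Bool) (b : Layer) where

  in-colour : ℕ → Bool → Layer → ℕ
  in-colour i x c = toℕ (x ∧ does (colour i c ≟ˡ b))

  next+prev : ∀ i x c → in-colour i x (next c) + (in-colour i x (prev c) + 0) ≡
                        differ (colour i c) b * toℕ x
  next+prev i x c
    rewrite colour-next i c | colour-prev i c
          | +-identityʳ (toℕ (x ∧ does (prev (colour i c) ≟ˡ b))) =
    other-two x (colour i c) b

  prev+next : ∀ i x c → in-colour i x (prev c) + (in-colour i x (next c) + 0) ≡
                        differ (colour i c) b * toℕ x
  prev+next i x c
    rewrite +-identityʳ (in-colour i x (next c))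
          | +-comm (in-colour i x (prev c)) (in-colour i x (next c))
          | sym (+-identityʳ (in-colour i x (prev c))) = next+prev i x c

  deg-triangle : ∀ i j c → deg (band g b) (j , c) (triangle i) ≡
    differ (colour j c) b * toℕ ((i ≡ᵇ j) ∧ g i)
  deg-triangle i j c with i ≟ j
  ... | no i≢j rewrite dec-false (i ≟ j) i≢j = sym (*-zeroʳ (differ (colour j c) b))
  deg-triangle i j U | yes refl rewrite dec-true (i ≟ i) refl
    | +-identityʳ (in-colour i (g i) V) = next+prev i (g i) U
  deg-triangle i j V | yes refl rewrite dec-true (i ≟ i) refl
    | +-identityʳ (in-colour i (g i) W) = prev+next i (g i) V
  deg-triangle i j W | yes refl rewrite dec-true (i ≟ i) refl
    | +-identityʳ (in-colour i (g i) U) = prev+next i (g i) W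

  -- Towards either side the neighbours are the two vertices of the adjacent layer with another
  -- colour, so the shift in `colour` reduces the count to that inside a single layer.
  deg-connect : ∀ i j c → deg (band g b) (j , c) (connect i) ≡
    differ (colour j c) b * (toℕ ((i ≡ᵇ j) ∧ g (suc i)) + toℕ ((suc i ≡ᵇ j) ∧ g i))
  deg-connect i j c with i ≟ j | suc i ≟ j
  ... | no i≢j | no 1+i≢j rewrite dec-false (i ≟ j) i≢j | dec-false (suc i ≟ j) 1+i≢j =
    sym (*-zeroʳ (differ (colour j c) b))
  ... | yes refl | yes ()
  -- Read through the shift, the neighbours `U` and `W` in layer `suc i` count as `W` and `V` of
  -- layer `i`.
  deg-connect i j U | yes refl | no ¬e rewrite dec-true (i ≟ i) refl | dec-false (suc i ≟ i) ¬e
    | +-identityʳ (in-colour i (g (suc i)) W) | +-identityʳ (in-colour i (g (suc i)) V)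
    | +-identityʳ (toℕ (g (suc i))) = prev+next i (g (suc i)) U
  deg-connect i j V | yes refl | no ¬e rewrite dec-true (i ≟ i) refl | dec-false (suc i ≟ i) ¬e
    | +-identityʳ (in-colour i (g (suc i)) U) | +-identityʳ (in-colour i (g (suc i)) W)
    | +-identityʳ (toℕ (g (suc i))) = prev+next i (g (suc i)) V
  deg-connect i j W | yes refl | no ¬e rewrite dec-true (i ≟ i) refl | dec-false (suc i ≟ i) ¬e
    | +-identityʳ (in-colour i (g (suc i)) U) | +-identityʳ (in-colour i (g (suc i)) V)
    | +-identityʳ (toℕ (g (suc i))) = prev+next i (g (suc i)) W
  -- `colour (suc i) U` is `colour i W`, and the neighbours in layer `i` carry the other two letters
  -- `U` and `V`.
  deg-connect i j U | no ¬e | yes refl rewrite dec-false (i ≟ suc i) ¬e | dec-true (i ≟ i) refl =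
    next+prev i (g i) W
  deg-connect i j V | no ¬e | yes refl rewrite dec-false (i ≟ suc i) ¬e | dec-true (i ≟ i) refl =
    next+prev i (g i) U
  deg-connect i j W | no ¬e | yes refl rewrite dec-false (i ≟ suc i) ¬e | dec-true (i ≟ i) refl =
    prev+next i (g i) V

-- The number of layers i ≤ n with g i and |i - j| ≤ 1 (zero if j > n), summed
-- block by block along the edge list of octPath n.
near : ℕ → (ℕ → Bool) → ℕ → ℕ
near zero    g j = toℕ ((0 ≡ᵇ j) ∧ g 0)
near (suc n) g j = near n g j
  + (toℕ ((n ≡ᵇ j) ∧ g (suc n)) + toℕ ((suc n ≡ᵇ j) ∧ g n) + toℕ ((suc n ≡ᵇ j) ∧ g (suc n)))

-- This reduces the game to a problem about `g` alone: the colour enters only as a factor 0 or 1.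
deg-band : ∀ g b n j c → deg (band g b) (j , c) (octPath n) ≡ differ (colour j c) b * near n g j
deg-band g b zero    j c = deg-triangle g b 0 j c
deg-band g b (suc n) j c = begin
  D (octPath n ++ (connect n ++ triangle (suc n)))
    ≡⟨ deg-++ P (j , c) (octPath n) _ ⟩
  D (octPath n) + D (connect n ++ triangle (suc n))
    ≡⟨ cong (D (octPath n) +_) (deg-++ P (j , c) (connect n) (triangle (suc n))) ⟩
  D (octPath n) + (D (connect n) + D (triangle (suc n)))
    ≡⟨ cong₂ _+_ (deg-band g b n j c) (cong₂ _+_ (deg-connect g b n j c) (deg-triangle g b (suc n) j c)) ⟩
  k * near n g j + (k * x + k * y)
    ≡⟨ cong (k * near n g j +_) (*-distribˡ-+ k x y) ⟨
  k * near n g j + k * (x + y)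
    ≡⟨ *-distribˡ-+ k (near n g j) (x + y) ⟨
  k * near (suc n) g j ∎
  where
  open ≡-Reasoning
  P = band g b
  D = deg P (j , c)
  k = differ (colour j c) b
  x = toℕ ((n ≡ᵇ j) ∧ g (suc n)) + toℕ ((suc n ≡ᵇ j) ∧ g n)
  y = toℕ ((suc n ≡ᵇ j) ∧ g (suc n))

deg-same-colour : ∀ g b n j c → colour j c ≡ b → deg (band g b) (j , c) (octPath n) ≡ 0
deg-same-colour g b n j c e =
  trans (deg-band g b n j c) (cong (λ t → (if t then 0 else 1) * near n g j) (dec-true (colour j c ≟ˡ b) e))

deg-other-colour : ∀ g b n j c → colour j c ≢ b → deg (band g b) (j , c) (octPath n) ≡ near n g j
deg-other-colour g b n j c e = trans (deg-band g b n j c)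
  (trans (cong (λ t → (if t then 0 else 1) * near n g j) (dec-false (colour j c ≟ˡ b) e)) (*-identityˡ _))

layer : ℕ → ℕ → Bool
layer p j = does (p ≟ j)

-- Lets edges to one vertex, in particular the start, be counted by the band formula; no colour
-- occurs twice in a layer, by `colour-injective`.
isV-band : ∀ p e z → isV (p , e) z ≡ band (layer p) (colour p e) z
isV-band p e (j , c) with p ≟ j
... | no p≢j rewrite dec-false (p ≟ j) p≢j = refl
... | yes refl rewrite dec-true (p ≟ p) refl with e ≟ˡ c
... | yes refl = sym (dec-true (colour p e ≟ˡ colour p e) refl)
... | no e≢c   = sym (dec-false (colour p c ≟ˡ colour p e) (λ q → e≢c (colour-injective p (sym q))))

deg-cong : ∀ {P Q} → (∀ z → P z ≡ Q z) → ∀ z E → deg P z E ≡ deg Q z E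
deg-cong P≗Q z []            = refl
deg-cong P≗Q z ((x , y) ∷ E) =
  cong₂ _+_ (cong₂ (λ s t → toℕ (isV x z ∧ s) + toℕ (isV y z ∧ t)) (P≗Q y) (P≗Q x)) (deg-cong P≗Q z E)

deg-isV : ∀ p e n z → deg (isV (p , e)) z (octPath n) ≡ deg (band (layer p) (colour p e)) z (octPath n)
deg-isV p e n z = deg-cong (isV-band p e) z (octPath n)

band-member : ∀ g b i c → band g b (i , c) ≡ true → colour i c ≡ b
band-member g b i c m with g i | colour i c ≟ˡ b
... | true  | yes e = e
band-member g b i c () | true  | no _
band-member g b i c () | false | _

independent-band : ∀ g b n z → band g b z ≡ true → deg (band g b) z (octPath n) ≡ 0
independent-band g b n (i , c) m = deg-same-colour g b n i c (band-member g b i c m)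

next≢ : ∀ c → c ≢ next c
next≢ U ()
next≢ V ()
next≢ W ()

-- Winning criteria in terms of layers.

-- Layer `p` is exempt from the parity condition, since its vertices other than the start are joined
-- to the start.
aliceWins-band : ∀ n p g → near n (layer p) p ≢ 0 → near n g p ≡ 1 →
                 (∀ j → j ≢ p → parity (near n g j) ≡ 0ℙ) → AliceWins (octPath n) (u p)
aliceWins-band n p g p-in one even =
  kernel⇒aliceWins (u p) (octPath n) (band g b) s∉P
    (trans (deg-other-colour g b n p U (next≢ s)) one) (independent-band g b n) harmless
  where
  s = colour p U
  b = next s

  s∉P : band g b (u p) ≡ false
  s∉P = trans (cong (g p ∧_) (dec-false (s ≟ˡ b) (next≢ s))) (∧-zeroʳ (g p))

  harmless : ∀ z → band g b z ≡ false → z ≢ u p → Harmless (u p) (band g b) (octPath n) z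
  harmless (j , c) _ z≢s with colour j c ≟ˡ b | j ≟ p
  ... | yes e | _      = inj₂ (cong parity (deg-same-colour g b n j c e))
  ... | no ¬e | no j≢p = inj₂ (trans (cong parity (deg-other-colour g b n j c ¬e)) (even j j≢p))
  ... | no ¬e | yes refl = inj₁ (subst (_≢ 0) (sym (trans (deg-isV p U n (p , c))
    (deg-other-colour (layer p) s n p c λ e → z≢s (cong (p ,_) (colour-injective p e))))) p-in)

-- Bob's set after Alice opens into layer q: g selects the layers in which it
-- contains the vertex of the starting colour.
record Reply (n p q : ℕ) : Set where
  constructor reply
  field
    g        : ℕ → Bool
    off      : g p ≡ false
    odd      : parity (near n g q) ≡ 1ℙ
    harmless : ∀ j → near n (layer p) j ≢ 0 ⊎ parity (near n g j) ≡ 0ℙ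

-- Vertices of the start's colour have no edge into the band, and the others in a layer at or next
-- to `p` are joined to the start. Alice can open only to a vertex of another colour, so the layer
-- `q` alone determines its count.
bobWins-band : ∀ n p → (∀ q → near n (layer q) p ≢ 0 → Reply n p q) → BobWins (octPath n) (u p)
bobWins-band n p choose = kernels⇒bobWins (u p) (octPath n) kernel
  where
  s = colour p U

  kernel : ∀ y → deg (isV y) (u p) (octPath n) ≢ 0 → ∃ λ P → KernelBut y (u p) P (octPath n)
  kernel (q , d) adjacent = band g s , record
    { s∉P         = cong (_∧ does (s ≟ˡ s)) off
    ; s-free      = deg-same-colour g s n p U refl
    ; independent = independent-band g s n
    ; harmless    = λ z _ _ _ → harmless z
    ; target-odd  = trans (cong parity (deg-other-colour g s n q d (≢-sym colours-differ))) odd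
    }
    where
    colours-differ : s ≢ colour q d
    colours-differ e = adjacent (trans (deg-isV q d n (u p)) (deg-same-colour (layer q) _ n p U e))

    open Reply (choose q (subst (_≢ 0)
      (trans (deg-isV q d n (u p)) (deg-other-colour (layer q) (colour q d) n p U colours-differ))
      adjacent))
      renaming (harmless to layer-harmless)

    harmless : ∀ z → Harmless (u p) (band g s) (octPath n) z
    harmless (j , c) with colour j c ≟ˡ s
    ... | yes e = inj₂ (cong parity (deg-same-colour g s n j c e))
    ... | no ¬e with layer-harmless j
    ... | inj₂ even = inj₂ (trans (cong parity (deg-other-colour g s n j c ¬e)) even)
    ... | inj₁ d≢0 = inj₁ (subst (_≢ 0)
      (sym (trans (deg-isV p U n (j , c)) (deg-other-colour (layer p) s n j c ¬e))) d≢0)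

-- Evaluating the layer counts.

layer-self : ∀ p → layer p p ≡ true
layer-self p = dec-true (p ≟ p) refl

layer-other : ∀ {p j} → p ≢ j → layer p j ≡ false
layer-other {p} {j} = dec-false (p ≟ j)

near-beyond : ∀ n g {j} → n < j → near n g j ≡ 0
near-beyond zero    g {suc j} _   = refl
near-beyond (suc n) g {j}     n<j
  rewrite near-beyond n g {j} (<-trans (n<1+n n) n<j)
        | dec-false (n ≟ j) (<⇒≢ (<-trans (n<1+n n) n<j)) | dec-false (suc n ≟ j) (<⇒≢ n<j) = refl

near-last : ∀ i g → near (suc i) g (suc i) ≡ toℕ (g i) + toℕ (g (suc i))
near-last i g
  rewrite near-beyond i g (n<1+n i) | dec-false (i ≟ suc i) (<⇒≢ (n<1+n i)) | layer-self i = refl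

near-extend : ∀ n g {j} → j < n → near (suc n) g j ≡ near n g j
near-extend n g {j} j<n
  rewrite dec-false (n ≟ j) (>⇒≢ j<n) | dec-false (suc n ≟ j) (>⇒≢ (m<n⇒m<1+n j<n)) = +-identityʳ _

near-inner : ∀ n g {j} → j < n → near n g j ≡ near j g j + toℕ (g (suc j))
near-inner (suc n) g {j} (s≤s j≤n) with m≤n⇒m<n∨m≡n j≤n
... | inj₁ j<n  = trans (near-extend n g j<n) (near-inner n g j<n)
... | inj₂ refl rewrite layer-self j | dec-false (suc j ≟ j) (>⇒≢ (n<1+n j)) =
  cong (near j g j +_) (trans (+-identityʳ _) (+-identityʳ _))

sum₃ : (ℕ → Bool) → ℕ → ℕ
sum₃ g i = toℕ (g i) + toℕ (g (suc i)) + toℕ (g (2 + i))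

-- With `g` off just past the path, the last layer obeys the formula of the inner ones.
near-closed : ∀ n g {j} → g (suc n) ≡ false → j ≤ n → near n g j ≡ near j g j + toℕ (g (suc j))
near-closed n g {j} end j≤n with m≤n⇒m<n∨m≡n j≤n
... | inj₁ j<n  = near-inner n g j<n
... | inj₂ refl rewrite end = sym (+-identityʳ _)

near-zero : ∀ n g → g (suc n) ≡ false → near n g 0 ≡ toℕ (g 0) + toℕ (g 1)
near-zero n g end = near-closed n g end z≤n

near-suc : ∀ n g {i} → g (suc n) ≡ false → suc i ≤ n → near n g (suc i) ≡ sum₃ g i
near-suc n g {i} end i<n =
  trans (near-closed n g end i<n) (cong (_+ toℕ (g (2 + i))) (near-last i g))

layer-beyond : ∀ {n p} → p ≤ n → layer p (suc n) ≡ false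
layer-beyond p≤n = layer-other (<⇒≢ (s≤s p≤n))

near-layer-self : ∀ {n p} → p ≤ n → near n (layer p) p ≢ 0
near-layer-self {n} {zero}  p≤n rewrite near-zero n (layer 0) (layer-beyond p≤n) = λ ()
near-layer-self {n} {suc p} p≤n rewrite near-suc n (layer (suc p)) (layer-beyond p≤n) p≤n
  | layer-self p | +-comm (toℕ (layer (suc p) p)) 1 = λ ()

near-layer-below : ∀ {n p} → p < n → near n (layer p) (suc p) ≢ 0
near-layer-below {n} {p} p<n rewrite near-suc n (layer p) (layer-beyond (<⇒≤ p<n)) p<n | layer-self p = λ ()

near-layer-above : ∀ {n p} → suc p ≤ n → near n (layer (suc p)) p ≢ 0
near-layer-above {n} {p} p<n
  rewrite near-inner n (layer (suc p)) p<n | layer-self p | +-comm (near p (layer (suc p)) p) 1 = λ ()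

-- Layers reachable by the opening move.

data Nearby (n p : ℕ) : ℕ → Set where
  same  : Nearby n p p
  above : suc p ≤ n → Nearby n p (suc p)
  below : ∀ {q} → p ≡ suc q → Nearby n p q

layer-member : ∀ {q j} → toℕ (layer q j) ≢ 0 → q ≡ j
layer-member {q} {j} l≢0 with q ≟ j
... | yes e  = e
... | no q≢j rewrite layer-other q≢j = contradiction refl l≢0

+-≢0 : ∀ {m n} → m + n ≢ 0 → m ≢ 0 ⊎ n ≢ 0
+-≢0 {zero}  n≢0 = inj₂ n≢0
+-≢0 {suc m} _   = inj₁ λ ()

nearby-self : ∀ {n p q} → near p (layer q) p ≢ 0 → Nearby n p q
nearby-self {p = zero} {q} ≢0 with refl ← layer-member {q} {0} ≢0 = same
nearby-self {p = suc p} {q} ≢0 with +-≢0 (subst (_≢ 0) (near-last p (layer q)) ≢0)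
... | inj₁ l≢0 = below (cong suc (sym (layer-member l≢0)))
... | inj₂ l≢0 with refl ← layer-member {q} {suc p} l≢0 = same

near-layer : ∀ {n p q} → p ≤ n → near n (layer q) p ≢ 0 → Nearby n p q
near-layer {n} {p} {q} p≤n ≢0 with m≤n⇒m<n∨m≡n p≤n
... | inj₂ refl = nearby-self ≢0
... | inj₁ p<n with +-≢0 (subst (_≢ 0) (near-inner n (layer q) p<n) ≢0)
... | inj₁ l≢0 = nearby-self l≢0
... | inj₂ l≢0 with refl ← layer-member {q} {suc p} l≢0 = above p<n

-- Patterns of period three.

periodic : Bool → Bool → Bool → ℕ → Bool
periodic a b c 0 = a
periodic a b c 1 = b
periodic a b c 2 = c
periodic a b c (suc (suc (suc i))) = periodic a b c i

periodic-suc : ∀ a b c i → periodic a b c (suc i) ≡ periodic b c a i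
periodic-suc a b c 0 = refl
periodic-suc a b c 1 = refl
periodic-suc a b c 2 = refl
periodic-suc a b c (suc (suc (suc i))) = periodic-suc a b c i

periodic-% : ∀ a b c i → periodic a b c i ≡ periodic a b c (i % 3)
periodic-% a b c 0 = refl
periodic-% a b c 1 = refl
periodic-% a b c 2 = refl
periodic-% a b c (suc (suc (suc i))) = periodic-% a b c i

Balanced : (ℕ → Bool) → Set
Balanced f = ∀ i → parity (sum₃ f i) ≡ 0ℙ

periodic-balanced : ∀ a b c → parity (toℕ a + toℕ b + toℕ c) ≡ 0ℙ → Balanced (periodic a b c)
periodic-balanced a b c even 0 = even
periodic-balanced a b c even 1 = trans (cong parity rotate) even
  where
  rotate : toℕ b + toℕ c + toℕ a ≡ toℕ a + toℕ b + toℕ c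
  rotate = trans (+-comm (toℕ b + toℕ c) (toℕ a)) (sym (+-assoc (toℕ a) _ _))
periodic-balanced a b c even 2 = trans (cong parity rotate) even
  where
  rotate : toℕ c + toℕ a + toℕ b ≡ toℕ a + toℕ b + toℕ c
  rotate = trans (+-assoc (toℕ c) _ _) (+-comm (toℕ c) _)
periodic-balanced a b c even (suc (suc (suc i))) = periodic-balanced a b c even i

sum₃-cong : ∀ {f g} i → g i ≡ f i → g (suc i) ≡ f (suc i) → g (2 + i) ≡ f (2 + i) → sum₃ g i ≡ sum₃ f i
sum₃-cong i e₀ e₁ e₂ = cong₂ _+_ (cong₂ _+_ (cong toℕ e₀) (cong toℕ e₁)) (cong toℕ e₂)

-- Layer 0 sees only layers 0 and 1, which cancel modulo 2 by `f 0 ≡ f 1`. The window of layer `j`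
-- reaches `j + 1`, hence `j < a`.
even-left : ∀ {n g f a j} → g (suc n) ≡ false → Balanced f → f 0 ≡ f 1 →
            (∀ i → i ≤ a → g i ≡ f i) → j < a → a ≤ n → parity (near n g j) ≡ 0ℙ
even-left {n} {g} {f} {a} {zero} end bal start agree j<a a≤n
  rewrite near-zero n g end | agree 0 z≤n | agree 1 j<a | start = double (f 1)
  where
  double : ∀ x → parity (toℕ x + toℕ x) ≡ 0ℙ
  double true  = refl
  double false = refl
even-left {n} {g} {f} {a} {suc i} end bal start agree j<a a≤n = trans (cong parity (trans
  (near-suc n g end (<⇒≤ (≤-trans j<a a≤n)))
  (sum₃-cong {f} {g} i (agree i (<⇒≤ (<⇒≤ j<a))) (agree (suc i) (<⇒≤ j<a)) (agree (2 + i) j<a)))) (bal i)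

-- The window of layer `j` starts at `j - 1`, hence `a < j`. At the end of the path the value at
-- `suc n`, which is off, stands in for the missing layer.
even-right : ∀ {n g f a j} → g (suc n) ≡ false → Balanced f →
             (∀ i → a ≤ i → g i ≡ f i) → a < j → parity (near n g j) ≡ 0ℙ
even-right {n} {g} {f} {a} {suc i} end bal agree (s≤s a≤i) with suc i ≤? n
... | no i≥n = cong parity (near-beyond n g (≰⇒> i≥n))
... | yes i<n = trans (cong parity (trans (near-suc n g end i<n)
  (sum₃-cong {f} {g} i (agree i a≤i) (agree _ (m≤n⇒m≤1+n a≤i))
                       (agree _ (m≤n⇒m≤1+n (m≤n⇒m≤1+n a≤i)))))) (bal i)

-- Gluing two patterns at the starting layer.

glue : ℕ → (ℕ → Bool) → (ℕ → Bool) → ℕ → Bool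
glue a f h i = if does (i <? a) then f i else h i

glue-< : ∀ {a f h i} → i < a → glue a f h i ≡ f i
glue-< {a} {f} {h} {i} i<a rewrite dec-true (i <? a) i<a = refl

glue-≥ : ∀ {a f h i} → a ≤ i → glue a f h i ≡ h i
glue-≥ {a} {f} {h} {i} a≤i rewrite dec-false (i <? a) (≤⇒≯ a≤i) = refl

none : ℕ → Bool
none _ = false

-- The missing layer under layer 0 counts as 0, so that one formula covers every `p`.
before : (ℕ → Bool) → ℕ → ℕ
before g zero    = 0
before g (suc i) = toℕ (g i)

near-centre : ∀ n g {p} → g (suc n) ≡ false → p ≤ n →
              near n g p ≡ before g p + toℕ (g p) + toℕ (g (suc p))
near-centre n g {zero}  end p≤n = near-zero n g end
near-centre n g {suc i} end p≤n = near-suc n g end p≤n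

before-glue : ∀ f h p → before (glue p f h) p ≡ before f p
before-glue f h zero    = refl
before-glue f h (suc i) = cong toℕ (glue-< {suc i} {f} {h} (n<1+n i))

before-periodic : ∀ a b c p → p ≢ 0 → before (periodic a b c) p ≡ toℕ (periodic c a b p)
before-periodic a b c zero    p≢0 = contradiction refl p≢0
before-periodic a b c (suc i) _   = cong toℕ (sym (periodic-suc c a b i))

-- Since `f` and `h` agree at `p`, every other layer sees a window of one pattern only; the mixed
-- window is that of `p`, which is exempt from parity and must count 1.
alice-glued : ∀ {n p} f h → p ≤ n → Balanced f → f 0 ≡ f 1 → Balanced h → h (suc n) ≡ false →
              f p ≡ h p → before f p + toℕ (h p) + toℕ (h (suc p)) ≡ 1 → AliceWins (octPath n) (u p)
alice-glued {n} {p} f h p≤n f-bal start h-bal end meet one =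
  aliceWins-band n p g (near-layer-self p≤n) (trans (near-centre n g g-end p≤n) (trans centre one)) even
  where
  g = glue p f h

  g-end : g (suc n) ≡ false
  g-end = trans (glue-≥ {p} {f} {h} (m≤n⇒m≤1+n p≤n)) end

  centre : before g p + toℕ (g p) + toℕ (g (suc p)) ≡ before f p + toℕ (h p) + toℕ (h (suc p))
  centre = cong₂ _+_ (cong₂ _+_ (before-glue f h p) (cong toℕ (glue-≥ {p} {f} {h} ≤-refl)))
                     (cong toℕ (glue-≥ {p} {f} {h} (n≤1+n p)))

  left : ∀ i → i ≤ p → g i ≡ f i
  left i i≤p with m≤n⇒m<n∨m≡n i≤p
  ... | inj₁ i<p  = glue-< {p} {f} {h} i<p
  ... | inj₂ refl = trans (glue-≥ {p} {f} {h} ≤-refl) (sym meet)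

  even : ∀ j → j ≢ p → parity (near n g j) ≡ 0ℙ
  even j j≢p with <-cmp j p
  ... | tri< j<p _ _ = even-left {f = f} g-end f-bal start left j<p p≤n
  ... | tri≈ _ e _   = contradiction e j≢p
  ... | tri> _ _ p<j = even-right {f = h} g-end h-bal (λ i → glue-≥ {p} {f} {h}) p<j

none-balanced : Balanced none
none-balanced i = refl

-- Bob's replies.

-- With `g` off up to `p` and equal to `h` above, only layers `p` and `p + 1` can see a broken
-- window, and their vertices of other colours are joined to the start.
module ReplyAbove {n p : ℕ} (p≤n : p ≤ n) (h : ℕ → Bool) (bal : Balanced h) (end : h (suc n) ≡ false) where

  g : ℕ → Bool
  g = glue (suc p) none h

  low : ∀ i → i ≤ p → g i ≡ false
  low i i≤p = glue-< {suc p} {none} {h} (s≤s i≤p)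

  high : ∀ i → suc p ≤ i → g i ≡ h i
  high i = glue-≥ {suc p} {none} {h}

  g-end : g (suc n) ≡ false
  g-end = trans (high (suc n) (s≤s p≤n)) end

  harmless : ∀ j → near n (layer p) j ≢ 0 ⊎ parity (near n g j) ≡ 0ℙ
  harmless j with <-cmp j p
  ... | tri< j<p _ _  = inj₂ (even-left {f = none} g-end none-balanced refl low j<p p≤n)
  ... | tri≈ _ refl _ = inj₁ (near-layer-self p≤n)
  ... | tri> _ _ p<j with m≤n⇒m<n∨m≡n p<j
  ... | inj₁ p+1<j = inj₂ (even-right {f = h} g-end bal high p+1<j)
  ... | inj₂ refl with suc p ≤? n
  ... | yes p<n = inj₁ (near-layer-below p<n)
  ... | no p≮n  = inj₂ (cong parity (near-beyond n g (≰⇒> p≮n)))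

  -- The window of layer `p + 1` is even for `h`, and `g` omits from it exactly the term `h p`,
  -- leaving an odd count.
  to-above : h p ≡ true → suc p ≤ n → Reply n p (suc p)
  to-above hp p<n = reply g (low p ≤-refl) odd harmless
    where
    open ≡-Reasoning
    odd : parity (near n g (suc p)) ≡ 1ℙ
    odd = begin
      parity (near n g (suc p))  ≡⟨ cong parity (near-suc n g g-end p<n) ⟩
      parity (sum₃ g p)
        ≡⟨ cong parity (cong₂ _+_ (cong₂ _+_ (cong toℕ (low p ≤-refl)) (cong toℕ (high (suc p) ≤-refl)))
                                  (cong toℕ (high (2 + p) (n≤1+n (suc p))))) ⟩
      parity m                   ≡⟨ suc-homo-⁻¹ m ⟨
      parity (suc m) ⁻¹
        ≡⟨ cong (λ x → parity (toℕ x + toℕ (h (suc p)) + toℕ (h (2 + p))) ⁻¹) hp ⟨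
      parity (sum₃ h p) ⁻¹       ≡⟨ cong _⁻¹ (bal p) ⟩
      1ℙ ∎
      where m = toℕ (h (suc p)) + toℕ (h (2 + p))

  to-same : h (suc p) ≡ true → Reply n p p
  to-same hp = reply g (low p ≤-refl) (cong parity (trans (near-centre n g g-end p≤n) centre)) harmless
    where
    centre : before g p + toℕ (g p) + toℕ (g (suc p)) ≡ 1
    centre = cong₂ _+_ (cong₂ _+_ (none-before p low) (cong toℕ (low p ≤-refl)))
                       (cong toℕ (trans (high (suc p) ≤-refl) hp))
      where
      none-before : ∀ p → (∀ i → i ≤ p → g i ≡ false) → before g p ≡ 0
      none-before zero    _   = refl
      none-before (suc i) low = cong toℕ (low i (n≤1+n i))

-- The mirror image of `ReplyAbove`; writing `p` as `suc i` guarantees a layer below.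
module ReplyBelow {n i : ℕ} (p≤n : suc i ≤ n) (f : ℕ → Bool) (bal : Balanced f) (start : f 0 ≡ f 1) where

  p : ℕ
  p = suc i

  g : ℕ → Bool
  g = glue p f none

  low : ∀ j → j ≤ i → g j ≡ f j
  low j j≤i = glue-< {p} {f} {none} (s≤s j≤i)

  high : ∀ j → p ≤ j → g j ≡ false
  high j = glue-≥ {p} {f} {none}

  g-end : g (suc n) ≡ false
  g-end = high (suc n) (m≤n⇒m≤1+n p≤n)

  harmless : ∀ j → near n (layer p) j ≢ 0 ⊎ parity (near n g j) ≡ 0ℙ
  harmless j with <-cmp j p
  ... | tri≈ _ refl _ = inj₁ (near-layer-self p≤n)
  ... | tri> _ _ p<j  = inj₂ (even-right {f = none} g-end none-balanced high p<j)
  ... | tri< (s≤s j≤i) _ _ with m≤n⇒m<n∨m≡n j≤i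
  ... | inj₁ j<i  = inj₂ (even-left {f = f} g-end bal start low j<i (<⇒≤ p≤n))
  ... | inj₂ refl = inj₁ (near-layer-above p≤n)

  to-same : f i ≡ true → Reply n p p
  to-same fi = reply g (high p ≤-refl) (cong parity (trans (near-suc n g g-end p≤n)
    (cong₂ _+_ (cong₂ _+_ (cong toℕ (trans (low i ≤-refl) fi)) (cong toℕ (high p ≤-refl)))
               (cong toℕ (high (suc p) (n≤1+n p)))))) harmless

  to-below : f p ≡ true → Reply n p i
  to-below fp = reply g (high p ≤-refl) (odd i refl) harmless
    where
    open ≡-Reasoning
    odd : ∀ k → k ≡ i → parity (near n g k) ≡ 1ℙ
    -- At layer 0 the window is `f 0 + f 1` with both terms on, and `g` omits `f 1`.
    odd zero refl = cong parity (trans (near-zero n g g-end)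
      (cong₂ _+_ (cong toℕ (trans (low 0 z≤n) (trans start fp))) (cong toℕ (high 1 ≤-refl))))
    odd (suc k) refl = begin
      parity (near n g (suc k))  ≡⟨ cong parity (near-suc n g g-end (<⇒≤ p≤n)) ⟩
      parity (sum₃ g k)
        ≡⟨ cong parity (cong₂ _+_ (cong₂ _+_ (cong toℕ (low k (n≤1+n k))) (cong toℕ (low (suc k) ≤-refl)))
                                  (cong toℕ (high p ≤-refl))) ⟩
      parity (m + 0)             ≡⟨ cong parity (+-identityʳ m) ⟩
      parity m                   ≡⟨ suc-homo-⁻¹ m ⟨
      parity (suc m) ⁻¹          ≡⟨ cong (λ x → parity x ⁻¹) (+-comm 1 m) ⟩
      parity (m + 1) ⁻¹          ≡⟨ cong (λ x → parity (m + toℕ x) ⁻¹) fp ⟨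
      parity (sum₃ f k) ⁻¹       ≡⟨ cong _⁻¹ (bal k) ⟩
      1ℙ ∎
      where m = toℕ (f k) + toℕ (f (suc k))

-- An opening above is answered with `h`, one below with `f`, and one inside layer `p` on a side
-- whose adjacent layer is on, which `side` provides.
bob-replies : ∀ {n p} f h → p ≤ n → Balanced f → f 0 ≡ f 1 → Balanced h → h (suc n) ≡ false →
              f p ≡ true → h p ≡ true → h (suc p) ≡ true ⊎ before f p ≡ 1 → BobWins (octPath n) (u p)
bob-replies {n} {p} f h p≤n f-bal start h-bal end fp hp side =
  bobWins-band n p λ q q-near → answer side (near-layer p≤n q-near)
  where
  module A = ReplyAbove p≤n h h-bal end

  below-true : ∀ {p} → p ≤ n → before f p ≡ 1 → Reply n p p
  below-true {suc i} p≤n one with f i in fi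
  ... | true = ReplyBelow.to-same p≤n f f-bal start fi

  answer : ∀ {q} → h (suc p) ≡ true ⊎ before f p ≡ 1 → Nearby n p q → Reply n p q
  answer _         (above p<n)  = A.to-above hp p<n
  answer _         (below refl) = ReplyBelow.to-below p≤n f f-bal start fp
  answer (inj₁ h+) same         = A.to-same h+
  answer (inj₂ f-) same         = below-true p≤n f-

-- Choice of patterns by residues modulo 3.

theorem1p5 : (n p : ℕ) → 1 ≤ n → p ≤ n →
    ((n % 3 ≡ 0) → AliceWins (octPath n) (u p))
    × ((n % 3 ≡ 1) → ((p % 3 ≡ 0 ⊎ p % 3 ≡ 1) → BobWins (octPath n) (u p))
    × (p % 3 ≡ 2 → AliceWins (octPath n) (u p)))
    × ((n % 3 ≡ 2) → (p % 3 ≡ 1 → BobWins (octPath n) (u p))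
    × ((p % 3 ≡ 0 ⊎ p % 3 ≡ 2) → AliceWins (octPath n) (u p)))
theorem1p5 n p _ p≤n =
    -- Patterns on the right are chosen to be off at layer `n + 1`: `101`, `110` and `011` for `n`
    -- congruent to 0, 1 and 2.
    (λ n≡0 → alice₀ n≡0 (p % 3) refl (m%n<n p 3))
  , (λ n≡1 → (λ { (inj₁ p≡0) → bob true true false refl n≡1 p≡0 refl refl refl (inj₁ refl)
               ; (inj₂ p≡1) → bob true true false refl n≡1 p≡1 refl refl refl (inj₂ ((λ ()) , refl)) })
           , from-left)
  , (λ n≡2 → (λ p≡1 → bob false true true refl n≡2 p≡1 refl refl refl (inj₁ refl))
           , λ { (inj₁ p≡0) → from-right false true true refl n≡2 p≡0 refl refl refl
               ; (inj₂ p≡2) → from-left p≡2 })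
  where
  at : ∀ a b c {r} → p % 3 ≡ r → periodic a b c p ≡ periodic a b c r
  at a b c p≡r = trans (periodic-% a b c p) (cong (periodic a b c) p≡r)

  at⁺ : ∀ a b c {r} → p % 3 ≡ r → periodic a b c (suc p) ≡ periodic b c a r
  at⁺ a b c p≡r = trans (periodic-suc a b c p) (at b c a p≡r)

  end : ∀ a b c {r} → n % 3 ≡ r → periodic a b c (suc n) ≡ periodic b c a r
  end a b c n≡r =
    trans (periodic-suc a b c n) (trans (periodic-% b c a n) (cong (periodic b c a) n≡r))

  left : ℕ → Bool
  left = periodic true true false

  left-balanced : Balanced left
  left-balanced = periodic-balanced true true false refl

  before-left : ∀ {r} → p % 3 ≡ r → r ≢ 0 → before left p ≡ toℕ (periodic false true true r)
  before-left p≡r r≢0 = trans (before-periodic true true false p λ { refl → r≢0 (sym p≡r) })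
                              (cong toℕ (at false true true p≡r))

  bob : ∀ a b c {r s} → parity (toℕ a + toℕ b + toℕ c) ≡ 0ℙ → n % 3 ≡ r → p % 3 ≡ s →
        periodic b c a r ≡ false → left s ≡ true → periodic a b c s ≡ true →
        periodic b c a s ≡ true ⊎ (s ≢ 0 × periodic false true true s ≡ true) →
        BobWins (octPath n) (u p)
  bob a b c even n≡r p≡s end≡ left≡ right≡ side =
    bob-replies left (periodic a b c) p≤n left-balanced refl (periodic-balanced a b c even)
      (trans (end a b c n≡r) end≡) (trans (at true true false p≡s) left≡)
      (trans (at a b c p≡s) right≡)
      (⊎-map (trans (at⁺ a b c p≡s)) (λ (s≢0 , e) → trans (before-left p≡s s≢0) (cong toℕ e)) side)

  -- The left pattern is off at `p` and on at `p - 1`; with nothing above, this gives the count 1.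
  from-left : p % 3 ≡ 2 → AliceWins (octPath n) (u p)
  from-left p≡2 = alice-glued left none p≤n left-balanced refl none-balanced refl
    (at true true false p≡2) (cong (λ x → x + 0 + 0) (before-left p≡2 λ ()))

  -- With nothing below and the pattern off at `p`, the layer `p + 1` is the sole contribution.
  from-right : ∀ a b c {r s} → parity (toℕ a + toℕ b + toℕ c) ≡ 0ℙ → n % 3 ≡ r → p % 3 ≡ s →
               periodic b c a r ≡ false → periodic a b c s ≡ false → periodic b c a s ≡ true →
               AliceWins (octPath n) (u p)
  from-right a b c even n≡r p≡s end≡ here≡ above≡ =
    alice-glued none (periodic a b c) p≤n none-balanced refl (periodic-balanced a b c even)
      (trans (end a b c n≡r) end≡) (sym hp)
      (cong₂ _+_ (cong₂ _+_ (none-before p) (cong toℕ hp))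
                 (cong toℕ (trans (at⁺ a b c p≡s) above≡)))
    where
    hp : periodic a b c p ≡ false
    hp = trans (at a b c p≡s) here≡

    none-before : ∀ p → before none p ≡ 0
    none-before zero    = refl
    none-before (suc _) = refl

  -- Both patterns are on at `p` and off next to it, so layer `p` itself supplies the one neighbour.
  from-both : n % 3 ≡ 0 → p % 3 ≡ 0 → AliceWins (octPath n) (u p)
  from-both n≡0 p≡0 = alice-glued left (periodic true false true) p≤n left-balanced refl
    (periodic-balanced true false true refl) (end true false true n≡0)
    (trans (at true true false p≡0) (sym (at true false true p≡0)))
    (cong₂ _+_ (cong₂ _+_ none-before (cong toℕ (at true false true p≡0)))
               (cong toℕ (at⁺ true false true p≡0)))
    where
    none-before : before left p ≡ 0
    none-before with p ≟ 0
    ... | yes refl = refl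
    ... | no p≢0   = trans (before-periodic true true false p p≢0) (cong toℕ (at false true true p≡0))

  alice₀ : n % 3 ≡ 0 → ∀ r → p % 3 ≡ r → r < 3 → AliceWins (octPath n) (u p)
  alice₀ n≡0 0 p≡0 _ = from-both n≡0 p≡0
  alice₀ n≡0 1 p≡1 _ = from-right true false true refl n≡0 p≡1 refl refl refl
  alice₀ n≡0 2 p≡2 _ = from-left p≡2
  alice₀ n≡0 (suc (suc (suc _))) _ (s≤s (s≤s (s≤s ())))
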